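{- The following four pairs $(X_1,X_2)$ of subsets of $\mathbb{Z}_{58}$ are four pairwise non-equivalent supplementary difference sets (SDS) with parameters $(58;27,24;22)$: (1) $X_1=\{0,1,2,3,4,7,8,10,11,12,13,16,18,20,24,26,29,31,32,33,36,38,43,46,47,50,53\}$, $X_2=\{0,1,2,3,7,8,10,11,12,13,16,17,21,22,24,27,30,34,41,42,43,45,47,49\}$; (2) $X_1=\{0,1,2,3,5,6,7,9,11,12,14,15,17,19,23,24,25,26,29,32,33,39,40,43,45,48,52\}$, $X_2=\{0,1,2,3,4,5,9,11,14,15,16,18,22,26,27,31,32,34,37,39,41,42,45,51\}$; (3) $X_1=\{0,1,2,3,5,8,9,11,12,13,14,18,19,21,24,25,27,29,32,34,35,39,41,43,44,48,49\}$, $X_2=\{0,2,3,4,6,8,10,13,16,17,19,20,21,25,28,29,32,33,34,39,40,41,43,46\}$; (4) $X_1=\{0,2,3,4,6,7,8,10,11,14,16,17,18,20,23,25,26,28,31,32,36,37,38,41,42,47,49\}$, $X_2=\{0,1,2,3,5,8,9,10,12,16,17,18,22,25,28,30,35,37,41,44,45,46,48,49\}$. These SDS give four respective pairs $A,B$ of $\{\pm1\}$-sequences of length $58$ (the sequences associated to $X_1$ and $X_2$) with zero periodic autocorrelation function, i.e. $\mathrm{PAF}_A(s)+\mathrm{PAF}_B(s)=0$ for all $s=1,\ldots,57$.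
   Context: Subsets $X_1,X_2\subseteq\mathbb{Z}_v$ with $|X_1|=r$, $|X_2|=s$ are supplementary difference sets (SDS) with parameters $(v;r,s;\lambda)$ if $\lambda(v-1)=r(r-1)+s(s-1)$ and for every nonzero $c\in\mathbb{Z}_v$ the number of triples $(i,a,b)$ with $i\in\{1,2\}$, $a,b\in X_i$ and $a-b=c$ is exactly $\lambda$. Two SDS with the same parameters $(v;r,s;\lambda)$, where $r\neq s$, are equivalent if one is obtained from the other by a finite sequence of the following operations: replacing one block $X_i$ by a translate $X_i+c$; replacing one block $X_i$ by $-X_i$; replacing both blocks simultaneously by $uX_1,uX_2$ with $u$ an integer relatively prime to $v$. The sequence associated to $X\subseteq\mathbb{Z}_v$ is $A=[a_0,\ldots,a_{v-1}]$ with $a_j=-1$ if $j\in X$ and $a_j=1$ otherwise. For a sequence $A$ of length $v$ (indices modulo $v$), the periodic autocorrelation function is $\mathrm{PAF}_A(s)=\sum_{j=0}^{v-1}a_{j+s}\overline{a_j}$, $s\in\mathbb{Z}_v$. -}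

module Defs where

open import Data.Bool using (if_then_else_)
open import Data.Fin using (Fin; toℕ; fromℕ<)
open import Data.Fin.Patterns using (0F; 1F; 2F; 3F)
open import Data.Fin.Properties using (any?; _≟_)
open import Data.Fin.Subset using (Subset; _∈_; ∣_∣; ⁅_⁆; ⋃)
open import Data.Fin.Subset.Properties using (_∈?_)
open import Data.Integer as ℤ using (ℤ; +_; -1ℤ; 1ℤ)
open import Data.Integer.Coprimality using (Coprime)
open import Data.Integer.DivMod using (_%ℕ_; n%ℕd<d)
open import Data.Integer.Properties using (+-0-commutativeMonoid)
open import Data.List as List using (List; []; _∷_; allFin; cartesianProduct; filter; length)
open import Data.Nat as ℕ using (ℕ; NonZero)
open import Data.Product using (_×_; _,_)
open import Data.Sum using (_⊎_)
open import Data.Vec as Vec using (Vec; []; _∷_; lookup; tabulate; _[_]%=_)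
open import Relation.Binary.Construct.Closure.ReflexiveTransitive using (Star)
open import Relation.Binary.PropositionalEquality using (_≡_; _≢_)
open import Relation.Nullary.Decidable using (Dec; ⌊_⌋; _×-dec_)
open import Algebra.Properties.CommutativeMonoid.Sum +-0-commutativeMonoid using (sum)

-- Residue classes modulo v are represented by their least nonnegative members.
ℤ/_ : ℕ → Set
ℤ/ v = Fin v

module _ {v : ℕ} .{{_ : NonZero v}} where

  residue : ℤ → ℤ/ v
  residue z = fromℕ< (n%ℕd<d z v)

  rep : ℤ/ v → ℤ
  rep a = + toℕ a

  infixl 6 _⊕_ _⊖_
  infixl 7 _⊙_

  _⊕_ _⊖_ : ℤ/ v → ℤ/ v → ℤ/ v
  a ⊕ b = residue (rep a ℤ.+ rep b)
  a ⊖ b = residue (rep a ℤ.- rep b)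

  ⊝_ : ℤ/ v → ℤ/ v
  ⊝ a = residue (ℤ.- rep a)

  _⊙_ : ℤ → ℤ/ v → ℤ/ v
  u ⊙ a = residue (u ℤ.* rep a)

  -- Direct image { f x | x ∈ X }.
  image : (ℤ/ v → ℤ/ v) → Subset v → Subset v
  image f X = tabulate λ y → ⌊ any? (λ x → (x ∈? X) ×-dec (f x ≟ y)) ⌋

  residues : List ℕ → Subset v
  residues ns = ⋃ (List.map (λ n → ⁅ residue (+ n) ⁆) ns)

Blocks : ℕ → Set
Blocks v = Vec (Subset v) 2

module _ {v : ℕ} .{{_ : NonZero v}} where

  IsDifferenceTriple : Blocks v → ℤ/ v → Fin 2 × ℤ/ v × ℤ/ v → Set
  IsDifferenceTriple X c (i , a , b) =
    a ∈ lookup X i × b ∈ lookup X i × a ⊖ b ≡ c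

  isDifferenceTriple? : (X : Blocks v) (c : ℤ/ v) (t : Fin 2 × ℤ/ v × ℤ/ v) →
                        Dec (IsDifferenceTriple X c t)
  isDifferenceTriple? X c (i , a , b) =
    (a ∈? lookup X i) ×-dec ((b ∈? lookup X i) ×-dec (a ⊖ b ≟ c))

  differenceCount : Blocks v → ℤ/ v → ℕ
  differenceCount X c =
    length (filter (isDifferenceTriple? X c)
                   (cartesianProduct (allFin 2)
                                     (cartesianProduct (allFin v) (allFin v))))

  -- Truncated subtraction is harmless here: v is nonzero, and r * (r ∸ 1)
  -- equals r (r - 1) also for r = 0.
  record IsSDS (r s l : ℕ) (X : Blocks v) : Set where
    field
      size₁       : ∣ lookup X 0F ∣ ≡ r
      size₂       : ∣ lookup X 1F ∣ ≡ s
      parameters  : l ℕ.* (v ℕ.∸ 1) ≡ r ℕ.* (r ℕ.∸ 1) ℕ.+ s ℕ.* (s ℕ.∸ 1)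
      differences : (c : ℤ/ v) → c ≢ residue (+ 0) → differenceCount X c ≡ l

  data Step (X : Blocks v) : Blocks v → Set where
    translate : (i : Fin 2) (c : ℤ/ v) → Step X (X [ i ]%= image (_⊕ c))
    negate    : (i : Fin 2) → Step X (X [ i ]%= image ⊝_)
    multiply  : (u : ℤ) → Coprime u (+ v) → Step X (Vec.map (image (u ⊙_)) X)

  -- The equivalence of SDS whose two blocks have different sizes, so that
  -- there is no operation exchanging the blocks.
  Equivalent : Blocks v → Blocks v → Set
  Equivalent = Star Step

  Sequence : Set
  Sequence = ℤ/ v → ℤ

  IsBinary : Sequence → Set
  IsBinary A = ∀ j → A j ≡ 1ℤ ⊎ A j ≡ -1ℤ

  sequence : Subset v → Sequence
  sequence X j = if ⌊ j ∈? X ⌋ then -1ℤ else 1ℤ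

  -- The complex conjugate in Σⱼ a_{j+s} \overline{a_j} is the identity on
  -- integer sequences.
  PAF : Sequence → ℤ/ v → ℤ
  PAF A s = sum (λ j → A (j ⊕ s) ℤ.* A j)

family : Fin 4 → Blocks 58
family 0F =
    residues (0 ∷ 1 ∷ 2 ∷ 3 ∷ 4 ∷ 7 ∷ 8 ∷ 10 ∷ 11 ∷ 12 ∷ 13 ∷ 16 ∷ 18 ∷ 20 ∷
             24 ∷ 26 ∷ 29 ∷ 31 ∷ 32 ∷ 33 ∷ 36 ∷ 38 ∷ 43 ∷ 46 ∷ 47 ∷ 50 ∷ 53 ∷ [])
  ∷ residues (0 ∷ 1 ∷ 2 ∷ 3 ∷ 7 ∷ 8 ∷ 10 ∷ 11 ∷ 12 ∷ 13 ∷ 16 ∷ 17 ∷ 21 ∷ 22 ∷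
             24 ∷ 27 ∷ 30 ∷ 34 ∷ 41 ∷ 42 ∷ 43 ∷ 45 ∷ 47 ∷ 49 ∷ [])
  ∷ []
family 1F =
    residues (0 ∷ 1 ∷ 2 ∷ 3 ∷ 5 ∷ 6 ∷ 7 ∷ 9 ∷ 11 ∷ 12 ∷ 14 ∷ 15 ∷ 17 ∷ 19 ∷
             23 ∷ 24 ∷ 25 ∷ 26 ∷ 29 ∷ 32 ∷ 33 ∷ 39 ∷ 40 ∷ 43 ∷ 45 ∷ 48 ∷ 52 ∷ [])
  ∷ residues (0 ∷ 1 ∷ 2 ∷ 3 ∷ 4 ∷ 5 ∷ 9 ∷ 11 ∷ 14 ∷ 15 ∷ 16 ∷ 18 ∷ 22 ∷ 26 ∷
             27 ∷ 31 ∷ 32 ∷ 34 ∷ 37 ∷ 39 ∷ 41 ∷ 42 ∷ 45 ∷ 51 ∷ [])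
  ∷ []
family 2F =
    residues (0 ∷ 1 ∷ 2 ∷ 3 ∷ 5 ∷ 8 ∷ 9 ∷ 11 ∷ 12 ∷ 13 ∷ 14 ∷ 18 ∷ 19 ∷ 21 ∷
             24 ∷ 25 ∷ 27 ∷ 29 ∷ 32 ∷ 34 ∷ 35 ∷ 39 ∷ 41 ∷ 43 ∷ 44 ∷ 48 ∷ 49 ∷ [])
  ∷ residues (0 ∷ 2 ∷ 3 ∷ 4 ∷ 6 ∷ 8 ∷ 10 ∷ 13 ∷ 16 ∷ 17 ∷ 19 ∷ 20 ∷ 21 ∷ 25 ∷
             28 ∷ 29 ∷ 32 ∷ 33 ∷ 34 ∷ 39 ∷ 40 ∷ 41 ∷ 43 ∷ 46 ∷ [])
  ∷ []
family 3F =
    residues (0 ∷ 2 ∷ 3 ∷ 4 ∷ 6 ∷ 7 ∷ 8 ∷ 10 ∷ 11 ∷ 14 ∷ 16 ∷ 17 ∷ 18 ∷ 20 ∷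
             23 ∷ 25 ∷ 26 ∷ 28 ∷ 31 ∷ 32 ∷ 36 ∷ 37 ∷ 38 ∷ 41 ∷ 42 ∷ 47 ∷ 49 ∷ [])
  ∷ residues (0 ∷ 1 ∷ 2 ∷ 3 ∷ 5 ∷ 8 ∷ 9 ∷ 10 ∷ 12 ∷ 16 ∷ 17 ∷ 18 ∷ 22 ∷ 25 ∷
             28 ∷ 30 ∷ 35 ∷ 37 ∷ 41 ∷ 44 ∷ 45 ∷ 46 ∷ 48 ∷ 49 ∷ [])
  ∷ []

{-# OPTIONS --safe #-}

-- The additive energy Σ_c r_X(c)² of a set X, where r_X(c) is the number of
-- ways to write c as a difference of two elements of X, does not change under
-- the affine bijections x ↦ u x + c of ℤ/v. Hence the energy of the first
-- block is an invariant of equivalence, and it already separates the four SDS.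
module Submission where

open import Data.Bool using (true; if_then_else_)
open import Data.Fin using (Fin; zero; suc; toℕ)
open import Data.Fin.Patterns using (0F; 1F)
open import Data.Fin.Permutation using (Permutation′; permutation; _⟨$⟩ʳ_)
import Data.Fin.Permutation as Permutation
open import Data.Fin.Properties using (all?; any?; _≟_; toℕ-injective; toℕ-fromℕ<; toℕ<n; fromℕ<-cong)
open import Data.Fin.Subset using (Subset; _∈_; ∣_∣)
open import Data.Fin.Subset.Properties using (_∈?_)
open import Data.Integer using (ℤ; +_; -_; _-_; 0ℤ; 1ℤ; -1ℤ; _+_; _*_)
import Data.Integer as ℤ
open import Data.Integer.Coprimality using (Coprime)
open import Data.Integer.DivMod using (_%ℕ_; _/ℕ_; n%ℕd<d; a≡a%ℕn+[a/ℕn]*n)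
import Data.Integer.Properties as ℤ
open import Data.Integer.Tactic.RingSolver using (solve-∀)
open import Data.List using ([]; _∷_; _++_; map; filter; length; tabulate; allFin; cartesianProduct)
open import Data.List.Properties using (filter-++; length-++)
open import Data.Nat using (ℕ; zero; suc; NonZero; _≤_)
import Data.Nat as ℕ
open import Data.Nat.Coprimality using (coprime-Bézout)
open import Data.Nat.DivMod using (m<n⇒m%n≡m)
open import Data.Nat.Divisibility using (divides; n∣m⇒m%n≡0)
open import Data.Nat.GCD using (module Bézout)
import Data.Nat.Properties as ℕ
open import Data.Product using (_×_; _,_; proj₁; proj₂; ∃; ∃₂)
open import Data.Sum using (inj₁; inj₂)
open import Data.Vec using (Vec; lookup; []; _∷_)
open import Data.Vec.Properties using (lookup⇒[]=; []=⇒lookup; lookup∘tabulate)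
open import Defs
open import Function using (_∘_; id; mk⇔; _⇔_; module Injection)
open import Function.Properties.Inverse using (↔⇒↣)
open import Relation.Binary.Construct.Closure.ReflexiveTransitive using (ε; _◅_)
open import Relation.Binary.PropositionalEquality using (_≡_; _≢_; refl; sym; trans; cong; cong₂; subst; module ≡-Reasoning)
open import Relation.Nullary using (¬_; contradiction)
open import Relation.Nullary.Decidable using (Dec; yes; no; does; ⌊_⌋; _×-dec_; _→-dec_; from-yes; isYes≗does; dec-true; does-⇔)
open import Relation.Unary using (Pred; Decidable)

open import Algebra.Properties.CommutativeMonoid.Sum ℕ.+-0-commutativeMonoid using (sum; sum-cong-≗; sum-permute)

open ≡-Reasoning

-- Arithmetic of residues

-- The distance between two numbers below `v` is itself below `v`, so it equals its own remainder
-- modulo `v`; divisibility by `v` makes that remainder zero.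
<-∣⇒≡ : ∀ {v m n} .{{_ : NonZero v}} → m ℕ.< v → n ℕ.< v →
        ∀ k → + m - + n ≡ k * + v → m ≡ n
<-∣⇒≡ {v} {m} {n} m<v n<v k eq =
  ℤ.+-injective (ℤ.i-j≡0⇒i≡j (+ m) (+ n) (ℤ.∣i∣≡0⇒i≡0 (begin
    d         ≡⟨ m<n⇒m%n≡m d<v ⟨
    d ℕ.% v   ≡⟨ n∣m⇒m%n≡0 d v (divides ℤ.∣ k ∣ (trans (cong ℤ.∣_∣ eq) (ℤ.abs-* k (+ v)))) ⟩
    0         ∎)))
  where
  d = ℤ.∣ + m - + n ∣
  d<v : d ℕ.< v
  d<v rewrite ℤ.m-n≡m⊖n m n =
    ℕ.≤-<-trans (ℤ.∣m⊝n∣≤m⊔n m n) (ℕ.⊔-lub m<v n<v)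

module _ {v : ℕ} .{{_ : NonZero v}} where

  residue-cong : ∀ z w k → z ≡ w + k * + v → residue {v} z ≡ residue w
  residue-cong z w k z≡w+kv =
    fromℕ<-cong (z %ℕ v) (w %ℕ v)
      -- The coefficient comes from subtracting the division identities of `z` and `w` and inserting
      -- `z = w + k v`.
      (<-∣⇒≡ (n%ℕd<d z v) (n%ℕd<d w v) (w /ℕ v + k - z /ℕ v) (begin
        + (z %ℕ v) - + (w %ℕ v)
          ≡⟨ regroup (+ (z %ℕ v)) (+ (w %ℕ v)) (z /ℕ v) (w /ℕ v) k (+ v) ⟩
        (+ (z %ℕ v) + z /ℕ v * + v) - ((+ (w %ℕ v) + w /ℕ v * + v) + k * + v) + q * + v
          ≡⟨ cong₂ (λ x y → x - (y + k * + v) + q * + v) (a≡a%ℕn+[a/ℕn]*n z v) (a≡a%ℕn+[a/ℕn]*n w v) ⟨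
        z - (w + k * + v) + q * + v
          ≡⟨ cong (λ x → x - (w + k * + v) + q * + v) z≡w+kv ⟩
        (w + k * + v) - (w + k * + v) + q * + v
          ≡⟨ cancel (w + k * + v) (q * + v) ⟩
        q * + v ∎))
      (n%ℕd<d z v) (n%ℕd<d w v)
    where
    q = w /ℕ v + k - z /ℕ v
    regroup : ∀ r s a b k n →
              r - s ≡ (r + a * n) - ((s + b * n) + k * n) + (b + k - a) * n
    regroup = solve-∀
    cancel : ∀ x y → x - x + y ≡ y
    cancel = solve-∀

  -- Together with `residue-cong`, the explicit multiple of `v` reduces the laws for nested residues
  -- below to ring identities over the integers.
  rep-residue : ∀ z → ∃ λ k → rep (residue {v} z) ≡ z + k * + v
  rep-residue z = - (z /ℕ v) , (begin
    + toℕ (residue {v} z)                               ≡⟨ cong +_ (toℕ-fromℕ< (n%ℕd<d z v)) ⟩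
    + (z %ℕ v)                                          ≡⟨ expand (+ (z %ℕ v)) (z /ℕ v) (+ v) ⟩
    + (z %ℕ v) + z /ℕ v * + v + - (z /ℕ v) * + v        ≡⟨ cong (_+ - (z /ℕ v) * + v) (a≡a%ℕn+[a/ℕn]*n z v) ⟨
    z + - (z /ℕ v) * + v                                ∎)
    where
    expand : ∀ r q n → r ≡ r + q * n + - q * n
    expand = solve-∀

  residue-rep : ∀ (a : ℤ/ v) → residue (rep a) ≡ a
  residue-rep a = toℕ-injective (trans (toℕ-fromℕ< (n%ℕd<d (rep a) v)) (m<n⇒m%n≡m (toℕ<n a)))

  residue-+ˡ : ∀ z w → residue {v} (rep (residue {v} z) + w) ≡ residue (z + w)
  residue-+ˡ z w with k , eq ← rep-residue z =
    residue-cong (rep (residue z) + w) (z + w) k (trans (cong (_+ w) eq) (comm z (k * + v) w))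
    where
    comm : ∀ x y w → x + y + w ≡ x + w + y
    comm = solve-∀

  residue-*ʳ : ∀ u z → residue {v} (u * rep (residue {v} z)) ≡ residue (u * z)
  residue-*ʳ u z with k , eq ← rep-residue z =
    residue-cong (u * rep (residue z)) (u * z) (u * k) (trans (cong (u *_) eq) (distrib u z k (+ v)))
    where
    distrib : ∀ u z k n → u * (z + k * n) ≡ u * z + u * k * n
    distrib = solve-∀

  residue-−ʳ : ∀ w z → residue {v} (w - rep (residue {v} z)) ≡ residue (w - z)
  residue-−ʳ w z with k , eq ← rep-residue z =
    residue-cong (w - rep (residue z)) (w - z) (- k) (trans (cong (λ x → w - x) eq) (distrib w z k (+ v)))
    where
    distrib : ∀ w z k n → w - (z + k * n) ≡ w - z + - k * n
    distrib = solve-∀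

  ⊖-involutive : ∀ (a b : ℤ/ v) → a ⊖ (a ⊖ b) ≡ b
  ⊖-involutive a b = begin
    a ⊖ (a ⊖ b)                       ≡⟨ residue-−ʳ (rep a) (rep a - rep b) ⟩
    residue (rep a - (rep a - rep b)) ≡⟨ cong residue (cancel (rep a) (rep b)) ⟩
    residue (rep b)                   ≡⟨ residue-rep b ⟩
    b                                 ∎
    where
    cancel : ∀ x y → x - (x - y) ≡ y
    cancel = solve-∀

  ⊖-⊕-comm : ∀ (a b c : ℤ/ v) → (a ⊖ b) ⊕ c ≡ (a ⊕ c) ⊖ b
  ⊖-⊕-comm a b c = begin
    (a ⊖ b) ⊕ c                        ≡⟨ residue-+ˡ (rep a - rep b) (rep c) ⟩
    residue (rep a - rep b + rep c)    ≡⟨ cong residue (comm (rep a) (rep b) (rep c)) ⟩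
    -- `x - y` unfolds to `x + - y`, so the law for sums applies with a negative summand.
    residue (rep a + rep c - rep b)    ≡⟨ residue-+ˡ (rep a + rep c) (- rep b) ⟨
    (a ⊕ c) ⊖ b                        ∎
    where
    comm : ∀ x y z → x - y + z ≡ x + z - y
    comm = solve-∀

  ⊕-⊖-cancel : ∀ (a c : ℤ/ v) → (a ⊕ c) ⊖ c ≡ a
  ⊕-⊖-cancel a c = begin
    (a ⊕ c) ⊖ c                        ≡⟨ residue-+ˡ (rep a + rep c) (- rep c) ⟩
    residue (rep a + rep c - rep c)    ≡⟨ cong residue (cancel (rep a) (rep c)) ⟩
    residue (rep a)                    ≡⟨ residue-rep a ⟩
    a                                  ∎
    where
    cancel : ∀ x y → x + y - y ≡ x
    cancel = solve-∀

  ⊙-distribˡ-⊖ : ∀ u (a b : ℤ/ v) → u ⊙ (a ⊖ b) ≡ u ⊙ a ⊖ u ⊙ b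
  ⊙-distribˡ-⊖ u a b = begin
    u ⊙ (a ⊖ b)                              ≡⟨ residue-*ʳ u (rep a - rep b) ⟩
    residue (u * (rep a - rep b))            ≡⟨ cong residue (distrib u (rep a) (rep b)) ⟩
    residue (u * rep a - u * rep b)          ≡⟨ residue-+ˡ (u * rep a) (- (u * rep b)) ⟨
    residue (rep (u ⊙ a) - u * rep b)        ≡⟨ residue-−ʳ (rep (u ⊙ a)) (u * rep b) ⟨
    u ⊙ a ⊖ u ⊙ b                            ∎
    where
    distrib : ∀ u x y → u * (x - y) ≡ u * x - u * y
    distrib = solve-∀

  ⊙-inverse : ∀ {u w k} → u * w ≡ 1ℤ + k * + v → ∀ (a : ℤ/ v) → u ⊙ (w ⊙ a) ≡ a
  ⊙-inverse {u} {w} {k} uw≡1+kv a = begin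
    u ⊙ (w ⊙ a)                 ≡⟨ residue-*ʳ u (w * rep a) ⟩
    residue (u * (w * rep a))   ≡⟨ residue-cong (u * (w * rep a)) (rep a) (k * rep a) expand ⟩
    residue (rep a)             ≡⟨ residue-rep a ⟩
    a                           ∎
    where
    distrib : ∀ k x n → (1ℤ + k * n) * x ≡ x + k * x * n
    distrib = solve-∀
    expand : u * (w * rep a) ≡ rep a + k * rep a * + v
    expand = begin
      u * (w * rep a)         ≡⟨ ℤ.*-assoc u w (rep a) ⟨
      u * w * rep a           ≡⟨ cong (_* rep a) uw≡1+kv ⟩
      (1ℤ + k * + v) * rep a  ≡⟨ distrib k (rep a) (+ v) ⟩
      rep a + k * rep a * + v ∎

  -- Makes negation a case of multiplication by a unit, so that the laws of `⊙` cover it.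
  ⊝≡-1⊙ : ∀ (a : ℤ/ v) → ⊝ a ≡ -1ℤ ⊙ a
  ⊝≡-1⊙ a = cong residue (sym (ℤ.-1*i≡-i (rep a)))

-- Units modulo n

coprime-ℕ⇒invertible : ∀ m n → Coprime (+ m) (+ n) → ∃₂ λ w k → + m * w ≡ 1ℤ + k * + n
coprime-ℕ⇒invertible m n coprime with coprime-Bézout coprime
... | Bézout.+- x y eq = + x , + y , (begin
  + m * + x          ≡⟨ ℤ.*-comm (+ m) (+ x) ⟩
  + x * + m          ≡⟨ ℤ.pos-* x m ⟨
  + (x ℕ.* m)        ≡⟨ cong +_ eq ⟨
  1ℤ + + (y ℕ.* n)   ≡⟨ cong (_+_ 1ℤ) (ℤ.pos-* y n) ⟩
  1ℤ + + y * + n     ∎)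
-- Here Bézout reads `1 + x m = y n`, so the inverse of `m` is `- x`:
-- `m (- x) = 1 - (1 + x m) = 1 - y n`.
... | Bézout.-+ x y eq = - + x , - + y , (begin
  + m * - + x                      ≡⟨ expand (+ m) (+ x) ⟩
  1ℤ - (1ℤ + + x * + m)            ≡⟨ cong (λ z → 1ℤ - (1ℤ + z)) (ℤ.pos-* x m) ⟨
  1ℤ - + (1 ℕ.+ x ℕ.* m)           ≡⟨ cong (λ z → 1ℤ - + z) eq ⟩
  1ℤ - + (y ℕ.* n)                 ≡⟨ cong (λ z → 1ℤ - z) (ℤ.pos-* y n) ⟩
  1ℤ - + y * + n                   ≡⟨ cong (_+_ 1ℤ) (ℤ.neg-distribˡ-* (+ y) (+ n)) ⟩
  1ℤ + - + y * + n                 ∎)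
  where
  expand : ∀ m x → m * - x ≡ 1ℤ - (1ℤ + x * m)
  expand = solve-∀

-- Integer coprimality is coprimality of absolute values, so `∣ u ∣` has an inverse; a negative sign
-- of `u` is moved onto it.
coprime⇒invertible : ∀ u n → Coprime u (+ n) → ∃₂ λ w k → u * w ≡ 1ℤ + k * + n
coprime⇒invertible u n coprime
  with w , k , eq ← coprime-ℕ⇒invertible ℤ.∣ u ∣ n coprime | ℤ.+∣i∣≡i⊎+∣i∣≡-i u
... | inj₁ ∣u∣≡u  = w , k , trans (cong (_* w) (sym ∣u∣≡u)) eq
... | inj₂ ∣u∣≡-u = - w , k , (begin
  u * - w             ≡⟨ swap u w ⟩
  - u * w             ≡⟨ cong (_* w) ∣u∣≡-u ⟨
  + ℤ.∣ u ∣ * w       ≡⟨ eq ⟩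
  1ℤ + k * + n        ∎)
  where
  swap : ∀ x y → x * - y ≡ - x * y
  swap = solve-∀

-- Counting

-- Iverson bracket: it turns counts into sums, which can be reindexed along permutations.
𝟙 : ∀ {a} {A : Set a} → Dec A → ℕ
𝟙 a? = if does a? then 1 else 0

𝟙-⇔ : ∀ {a b} {A : Set a} {B : Set b} → A ⇔ B → (a? : Dec A) (b? : Dec B) → 𝟙 a? ≡ 𝟙 b?
𝟙-⇔ A⇔B a? b? = cong (if_then 1 else 0) (does-⇔ A⇔B a? b?)

𝟙-no : ∀ {a} {A : Set a} (a? : Dec A) → ¬ A → 𝟙 a? ≡ 0
𝟙-no (yes a) ¬a = contradiction a ¬a
𝟙-no (no _)  _  = refl

𝟙-× : ∀ {a b} {A : Set a} {B : Set b} (a? : Dec A) (b? : Dec B) →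
      𝟙 (a? ×-dec b?) ≡ 𝟙 a? ℕ.* 𝟙 b?
𝟙-× (yes _) b? = sym (ℕ.+-identityʳ (𝟙 b?))
𝟙-× (no _)  b? = refl

sum-zero : ∀ {n} (t : Fin n → ℕ) → (∀ j → t j ≡ 0) → sum t ≡ 0
sum-zero {zero}  t t≗0 = refl
sum-zero {suc n} t t≗0 = cong₂ ℕ._+_ (t≗0 zero) (sum-zero (t ∘ suc) (t≗0 ∘ suc))

sum-supported : ∀ {n} (t : Fin n → ℕ) i → (∀ j → j ≢ i → t j ≡ 0) → sum t ≡ t i
sum-supported t zero t≡0 =
  trans (cong (t zero ℕ.+_) (sum-zero (t ∘ suc) λ j → t≡0 (suc j) λ ())) (ℕ.+-identityʳ (t zero))
sum-supported t (suc i) t≡0 =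
  cong₂ ℕ._+_ (t≡0 zero λ ())
    (sum-supported (t ∘ suc) i λ j j≢i → t≡0 (suc j) λ { refl → j≢i refl })

module _ {a p} {A : Set a} {P : Pred A p} (P? : Decidable P) where

  length-filter-tabulate : ∀ {n} (f : Fin n → A) →
                           length (filter P? (tabulate f)) ≡ sum (λ i → 𝟙 (P? (f i)))
  length-filter-tabulate {zero}  f = refl
  length-filter-tabulate {suc n} f with P? (f zero)
  ... | yes _ = cong suc (length-filter-tabulate (f ∘ suc))
  ... | no  _ = length-filter-tabulate (f ∘ suc)

  length-filter-map : ∀ {b} {B : Set b} (f : B → A) xs →
                      length (filter P? (map f xs)) ≡ length (filter (P? ∘ f) xs)
  length-filter-map f []       = refl
  length-filter-map f (x ∷ xs) with P? (f x)
  ... | yes _ = cong suc (length-filter-map f xs)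
  ... | no  _ = length-filter-map f xs

-- The first factor is tabulated from an arbitrary `f` because the induction replaces `f` by
-- `f ∘ suc`; `allFin` is the case `f = id`.
length-filter-cartesianProduct :
  ∀ {a b p} {A : Set a} {B : Set b} {P : Pred (A × B) p} (P? : Decidable P)
  {n} (f : Fin n → A) ys →
  length (filter P? (cartesianProduct (tabulate f) ys)) ≡
  sum (λ i → length (filter (λ y → P? (f i , y)) ys))
length-filter-cartesianProduct P? {zero}  f ys = refl
length-filter-cartesianProduct P? {suc n} f ys = begin
  length (filter P? (row ++ rows))                        ≡⟨ cong length (filter-++ P? row rows) ⟩
  length (filter P? row ++ filter P? rows)                ≡⟨ length-++ (filter P? row) ⟩
  length (filter P? row) ℕ.+ length (filter P? rows)      ≡⟨ cong₂ ℕ._+_ (length-filter-map P? (f zero ,_) ys)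
                                                               (length-filter-cartesianProduct P? (f ∘ suc) ys) ⟩
  length (filter (λ y → P? (f zero , y)) ys) ℕ.+
    sum (λ i → length (filter (λ y → P? (f (suc i) , y)) ys)) ∎
  where
  row  = map (f zero ,_) ys
  rows = cartesianProduct (tabulate (f ∘ suc)) ys

-- Differences and additive energy

module _ {v : ℕ} .{{_ : NonZero v}} where

  -- The pairs (a , b) of elements of X with a - b = c, indexed by a.
  representations : Subset v → ℤ/ v → ℕ
  representations X c = sum λ a → 𝟙 (a ∈? X) ℕ.* 𝟙 (a ⊖ c ∈? X)

  energy : Subset v → ℕ
  energy X = sum λ c → representations X c ℕ.* representations X c

  -- Once `a` and `c` are fixed, `b` is forced to be `a ⊖ c`, so the sum over `b` collapses to one
  -- term. The resulting single sum per block is also much cheaper to evaluate than the list of all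
  -- triples.
  differenceCount≡representations : ∀ X c →
    differenceCount X c ≡ sum (λ i → representations (lookup X i) c)
  differenceCount≡representations X c = begin
    differenceCount X c
      ≡⟨ length-filter-cartesianProduct (isDifferenceTriple? X c) id pairs ⟩
    sum (λ i → length (filter (λ p → isDifferenceTriple? X c (i , p)) pairs))
      ≡⟨ sum-cong-≗ (λ i → length-filter-cartesianProduct (λ p → isDifferenceTriple? X c (i , p)) id (allFin v)) ⟩
    sum (λ i → sum λ a → length (filter (λ b → isDifferenceTriple? X c (i , a , b)) (allFin v)))
      ≡⟨ sum-cong-≗ (λ i → sum-cong-≗ λ a → length-filter-tabulate (λ b → isDifferenceTriple? X c (i , a , b)) id) ⟩
    sum (λ i → sum λ a → sum λ b → 𝟙 (isDifferenceTriple? X c (i , a , b)))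
      ≡⟨ sum-cong-≗ (λ i → sum-cong-≗ λ a → onlyDifference i a) ⟩
    sum (λ i → representations (lookup X i) c) ∎
    where
    pairs = cartesianProduct (allFin v) (allFin v)
    onlyDifference : ∀ i a →
      sum (λ b → 𝟙 (isDifferenceTriple? X c (i , a , b))) ≡
      𝟙 (a ∈? lookup X i) ℕ.* 𝟙 (a ⊖ c ∈? lookup X i)
    onlyDifference i a = begin
      sum (λ b → 𝟙 (isDifferenceTriple? X c (i , a , b)))
        -- If `a ⊖ b ≡ c`, then `b ≡ a ⊖ (a ⊖ b) ≡ a ⊖ c`.
        ≡⟨ sum-supported _ (a ⊖ c) (λ b b≢a⊖c → 𝟙-no (isDifferenceTriple? X c (i , a , b))
             λ (_ , _ , a⊖b≡c) → b≢a⊖c (trans (sym (⊖-involutive a b)) (cong (a ⊖_) a⊖b≡c))) ⟩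
      𝟙 (isDifferenceTriple? X c (i , a , a ⊖ c))
        ≡⟨ 𝟙-⇔ (mk⇔ (λ (p , q , _) → p , q) (λ (p , q) → p , q , ⊖-involutive a c))
             (isDifferenceTriple? X c (i , a , a ⊖ c)) ((a ∈? lookup X i) ×-dec (a ⊖ c ∈? lookup X i)) ⟩
      𝟙 ((a ∈? lookup X i) ×-dec (a ⊖ c ∈? lookup X i))
        ≡⟨ 𝟙-× (a ∈? lookup X i) (a ⊖ c ∈? lookup X i) ⟩
      𝟙 (a ∈? lookup X i) ℕ.* 𝟙 (a ⊖ c ∈? lookup X i) ∎

  -- Images and invariance under affine bijections

  ∈-image⁺ : ∀ f {X : Subset v} {a} → a ∈ X → f a ∈ image f X
  ∈-image⁺ f {X} {a} a∈X = lookup⇒[]= (f a) (image f X) (begin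
    lookup (image f X) (f a)                       ≡⟨ lookup∘tabulate _ (f a) ⟩
    ⌊ any? (λ x → (x ∈? X) ×-dec (f x ≟ f a)) ⌋    ≡⟨ isYes≗does (any? _) ⟩
    does (any? (λ x → (x ∈? X) ×-dec (f x ≟ f a))) ≡⟨ dec-true (any? _) (a , a∈X , refl) ⟩
    true                                           ∎)

  ∈-image⁻ : ∀ f {X : Subset v} {y} → y ∈ image f X → ∃ λ a → a ∈ X × f a ≡ y
  ∈-image⁻ f {X} {y} y∈fX = witness (any? _) (trans (sym (lookup∘tabulate _ y)) ([]=⇒lookup y∈fX))
    where
    witness : ∀ {A : Set} (a? : Dec A) → ⌊ a? ⌋ ≡ true → A
    witness (yes a) _ = a

  -- `π` is an affine bijection acting on elements and `τ` is its linear part acting on differences: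
  -- for `π x = u x + d`, `π (a - c) = π a - u c`.
  module _ (π τ : Permutation′ v) (π-⊖ : ∀ a c → π ⟨$⟩ʳ (a ⊖ c) ≡ (π ⟨$⟩ʳ a) ⊖ (τ ⟨$⟩ʳ c)) where

    private
      π[_] = image (π ⟨$⟩ʳ_)

    𝟙-∈-image : ∀ X a → 𝟙 ((π ⟨$⟩ʳ a) ∈? π[ X ]) ≡ 𝟙 (a ∈? X)
    𝟙-∈-image X a = 𝟙-⇔ (mk⇔ preimage (∈-image⁺ (π ⟨$⟩ʳ_))) ((π ⟨$⟩ʳ a) ∈? π[ X ]) (a ∈? X)
      where
      preimage : (π ⟨$⟩ʳ a) ∈ π[ X ] → a ∈ X
      preimage πa∈πX with b , b∈X , πb≡πa ← ∈-image⁻ (π ⟨$⟩ʳ_) πa∈πX =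
        subst (_∈ X) (Injection.injective (↔⇒↣ π) πb≡πa) b∈X

    -- Substitute `y = π a`. Then `y ⊖ τ c` is `π (a ⊖ c)`, and injectivity of `π` turns both
    -- membership tests for the image into tests for `X`.
    representations-image : ∀ X c → representations π[ X ] (τ ⟨$⟩ʳ c) ≡ representations X c
    representations-image X c = begin
      sum (λ y → 𝟙 (y ∈? π[ X ]) ℕ.* 𝟙 (y ⊖ (τ ⟨$⟩ʳ c) ∈? π[ X ]))
        ≡⟨ sum-permute _ π ⟩
      sum (λ a → 𝟙 ((π ⟨$⟩ʳ a) ∈? π[ X ]) ℕ.* 𝟙 ((π ⟨$⟩ʳ a) ⊖ (τ ⟨$⟩ʳ c) ∈? π[ X ]))
        ≡⟨ sum-cong-≗ (λ a → cong₂ ℕ._*_ (𝟙-∈-image X a)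
             (trans (cong (λ y → 𝟙 (y ∈? π[ X ])) (sym (π-⊖ a c))) (𝟙-∈-image X (a ⊖ c)))) ⟩
      representations X c ∎

    -- The representation counts are only permuted by `τ`, so the sum of their squares is unchanged.
    energy-image : ∀ X → energy π[ X ] ≡ energy X
    energy-image X = begin
      energy π[ X ]
        ≡⟨ sum-permute _ τ ⟩
      sum (λ c → representations π[ X ] (τ ⟨$⟩ʳ c) ℕ.* representations π[ X ] (τ ⟨$⟩ʳ c))
        ≡⟨ sum-cong-≗ (λ c → cong₂ ℕ._*_ (representations-image X c) (representations-image X c)) ⟩
      energy X ∎

  energy-translate : ∀ X c → energy (image (_⊕ c) X) ≡ energy X
  energy-translate X c =
    energy-image
      (permutation (_⊕ c) (_⊖ c)
        (λ a → trans (⊖-⊕-comm a c c) (⊕-⊖-cancel a c))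
        (λ a → ⊕-⊖-cancel a c))
      -- A translation leaves differences fixed, so its linear part is the identity.
      Permutation.id (λ a b → ⊖-⊕-comm a b c) X

  energy-negate : ∀ X → energy (image ⊝_ X) ≡ energy X
  energy-negate X = energy-image ⊝-permutation ⊝-permutation ⊝-⊖ X
    where
    ⊝-involutive : ∀ (a : ℤ/ v) → ⊝ (⊝ a) ≡ a
    ⊝-involutive a = begin
      ⊝ (⊝ a)             ≡⟨ ⊝≡-1⊙ (⊝ a) ⟩
      -1ℤ ⊙ (⊝ a)         ≡⟨ cong (-1ℤ ⊙_) (⊝≡-1⊙ a) ⟩
      -1ℤ ⊙ (-1ℤ ⊙ a)     ≡⟨ ⊙-inverse {u = -1ℤ} {w = -1ℤ} {k = 0ℤ} refl a ⟩
      a                   ∎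
    ⊝-permutation = permutation ⊝_ ⊝_ ⊝-involutive ⊝-involutive
    ⊝-⊖ : ∀ a b → ⊝ (a ⊖ b) ≡ (⊝ a) ⊖ (⊝ b)
    ⊝-⊖ a b = begin
      ⊝ (a ⊖ b)              ≡⟨ ⊝≡-1⊙ (a ⊖ b) ⟩
      -1ℤ ⊙ (a ⊖ b)          ≡⟨ ⊙-distribˡ-⊖ -1ℤ a b ⟩
      -1ℤ ⊙ a ⊖ -1ℤ ⊙ b      ≡⟨ cong₂ _⊖_ (⊝≡-1⊙ a) (⊝≡-1⊙ b) ⟨
      (⊝ a) ⊖ (⊝ b)          ∎

  -- Coprimality provides the inverse `w` that makes `u ⊙_` a permutation; being linear, this map is
  -- its own linear part.
  energy-multiply : ∀ X u → Coprime u (+ v) → energy (image (u ⊙_) X) ≡ energy X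
  energy-multiply X u coprime with w , k , uw≡1+kv ← coprime⇒invertible u v coprime =
    energy-image u⊙-permutation u⊙-permutation (⊙-distribˡ-⊖ u) X
    where
    u⊙-permutation = permutation (u ⊙_) (w ⊙_)
      (⊙-inverse {u = u} {w = w} {k = k} uw≡1+kv)
      (⊙-inverse {u = w} {w = u} {k = k} (trans (ℤ.*-comm w u) uw≡1+kv))

  -- Each step acts on the first block by an affine bijection or leaves it untouched; the second
  -- case holds by computation.
  energy-step : ∀ {X Y : Blocks v} → Step X Y → energy (lookup X 0F) ≡ energy (lookup Y 0F)
  energy-step {X ∷ _} (translate 0F c)       = sym (energy-translate X c)
  energy-step {_ ∷ _} (translate (suc _) _)  = refl
  energy-step {X ∷ _} (negate 0F)            = sym (energy-negate X)
  energy-step {_ ∷ _} (negate (suc _))       = refl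
  energy-step {X ∷ _} (multiply u coprime)   = sym (energy-multiply X u coprime)

  energy-equivalent : ∀ {X Y : Blocks v} → Equivalent X Y → energy (lookup X 0F) ≡ energy (lookup Y 0F)
  energy-equivalent ε              = refl
  energy-equivalent (step ◅ steps) = trans (energy-step step) (energy-equivalent steps)

  sequence-binary : ∀ X → IsBinary (sequence X)
  sequence-binary X j with j ∈? X
  ... | yes _ = inj₂ refl
  ... | no  _ = inj₁ refl

-- The four SDS

-- Computed values for the first blocks, confirmed by evaluation in `family-energy`; that they are
-- pairwise distinct is what rules out equivalence.
energies : Vec ℕ 4
energies = 9413 ∷ 9411 ∷ 9443 ∷ 9419 ∷ []

family-energy : ∀ k → energy (lookup (family k) 0F) ≡ lookup energies k
family-energy = from-yes (all? {n = 4} λ k →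
  energy (lookup (family k) 0F) ℕ.≟ lookup energies k)

energies-injective : ∀ k l → lookup energies k ≡ lookup energies l → k ≡ l
energies-injective = from-yes (all? {n = 4} λ k → all? {n = 4} λ l →
  (lookup energies k ℕ.≟ lookup energies l) →-dec (k ≟ l))

family-energy-injective : ∀ k l →
  energy (lookup (family k) 0F) ≡ energy (lookup (family l) 0F) → k ≡ l
family-energy-injective k l eq =
  energies-injective k l (trans (sym (family-energy k)) (trans eq (family-energy l)))

-- `suc c` with `c : Fin 57` runs through exactly the nonzero residues modulo 58. The finitely many
-- equations are decided by evaluation.
family-representations : ∀ k (c : Fin 57) →
  sum (λ i → representations (lookup (family k) i) (suc c)) ≡ 22
family-representations = from-yes (all? {n = 4} λ k → all? {n = 57} λ c →
  sum (λ i → representations (lookup (family k) i) (suc c)) ℕ.≟ 22)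

family-sizes : ∀ k → ∣ lookup (family k) 0F ∣ ≡ 27 × ∣ lookup (family k) 1F ∣ ≡ 24
family-sizes = from-yes (all? {n = 4} λ k →
  (∣ lookup (family k) 0F ∣ ℕ.≟ 27) ×-dec (∣ lookup (family k) 1F ∣ ℕ.≟ 24))

family-isSDS : ∀ k → IsSDS 27 24 22 (family k)
family-isSDS k = record
  { size₁       = proj₁ (family-sizes k)
  ; size₂       = proj₂ (family-sizes k)
  -- Both sides evaluate to 1254: `22 * 57 = 27 * 26 + 24 * 23`.
  ; parameters  = refl
  ; differences = differences
  }
  where
  differences : ∀ c → c ≢ residue (+ 0) → differenceCount (family k) c ≡ 22
  differences zero    0≢0 = contradiction refl 0≢0
  differences (suc c) _   =
    trans (differenceCount≡representations (family k) (suc c)) (family-representations k c)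

PAF₁+PAF₂ : Fin 4 → ℕ → ℤ
PAF₁+PAF₂ k s =
  PAF (sequence (lookup (family k) 0F)) (residue (+ s)) +
  PAF (sequence (lookup (family k) 1F)) (residue (+ s))

-- Decided by evaluation at every shift from 1 to 57. The value agrees with
-- `2 * 58 - 4 * (27 + 24 - 22) = 0`, which the SDS parameters predict.
family-PAF : ∀ k {s} → s ℕ.< 57 → PAF₁+PAF₂ k (suc s) ≡ 0ℤ
family-PAF = from-yes (all? {n = 4} λ k → ℕ.allUpTo? (λ s → PAF₁+PAF₂ k (suc s) ℤ.≟ 0ℤ) 57)

mainTheorem3 :
    ((k : Fin 4) → IsSDS 27 24 22 (family k))
    × ((k l : Fin 4) → k ≢ l → ¬ Equivalent (family k) (family l))
    × ((k : Fin 4) →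
         let A = sequence (lookup (family k) 0F)
             B = sequence (lookup (family k) 1F)
         in IsBinary A × IsBinary B
            × ((s : ℕ) → 1 ≤ s → s ≤ 57 →
                 PAF A (residue (+ s)) + PAF B (residue (+ s)) ≡ 0ℤ))
mainTheorem3 =
    family-isSDS
  , (λ k l k≢l k~l → k≢l (family-energy-injective k l (energy-equivalent k~l)))
  -- For a shift `suc s`, the bound `suc s ≤ 57` is by definition `s < 57`; shift zero is excluded
  -- by `1 ≤ s`.
  , λ k → sequence-binary _ , sequence-binary _ , λ { (suc s) _ s<57 → family-PAF k s<57 }
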